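{- Let $G$ be a finite connected graph (multiple edges allowed, no loops) that is not a regular bipartite graph. Let $w \in V(G)$ and $\lambda \in \{0,1\}$. Then $G$ has a spanning weakly even $(w,\lambda)$-tree. In particular, every connected graph that is not regular bipartite has a spanning tree in which all leaves of maximum degree in $G$ lie in the same part of the tree's bipartition, and every regular nonbipartite connected graph has a spanning tree all of whose leaves lie in the same part of the tree's bipartition.
   Context: Graphs are finite, may have multiple edges, but no loops. $\Delta(G)$ denotes the maximum degree of $G$. Given an ordered bipartition $(X,Y)$ of a bipartite graph $H$, a vertex of $H$ is type-$0$ if it lies in $X$ and type-$1$ if it lies in $Y$. For $w \in V(H)$ and $\lambda \in \{0,1\}$, the $(w,\lambda)$-bipartition of a connected bipartite graph $H$ is the ordered bipartition of $H$ in which $w$ has type $\lambda$; a $(w,\lambda)$-tree is a tree equipped with its $(w,\lambda)$-bipartition. A tree $T \subseteq G$ with ordered bipartition $(X,Y)$ is weakly even (in $G$) if every leaf of $T$ that has degree $\Delta(G)$ in $G$ is type-$0$ (i.e. lies in $X$). -}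

module Defs where

open import Data.Nat using (ℕ; zero; suc; _⊔_; _≥_; _∸_)
open import Data.Nat.ListAction using (sum)
open import Data.Bool using (Bool; true; false; if_then_else_; _∨_)
open import Data.Fin using (Fin; _≟_)
open import Data.List using (List; []; _∷_; map; foldr; allFin; length)
open import Data.List.Relation.Unary.Unique.Propositional using (Unique)
open import Data.Product using (Σ; _×_; _,_; proj₁; proj₂; ∃)
open import Data.Sum using (_⊎_)
open import Relation.Binary.PropositionalEquality using (_≡_)
open import Relation.Nullary using (¬_; does)

record Graph (n m : ℕ) : Set where
  field
    ends     : Fin m → Fin n × Fin n
    loopless : ∀ e → ¬ (proj₁ (ends e) ≡ proj₂ (ends e))
open Graph public

module _ {n m : ℕ} (G : Graph n m) where

  EdgeSet : Set
  EdgeSet = Fin m → Bool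

  allEdges : EdgeSet
  allEdges _ = true

  Joins : Fin m → Fin n → Fin n → Set
  Joins e u v = (ends G e ≡ (u , v)) ⊎ (ends G e ≡ (v , u))

  data Walk (S : EdgeSet) : Fin n → Fin n → Set where
    []   : ∀ {u} → Walk S u u
    step : ∀ {u v w} (e : Fin m) → S e ≡ true → Joins e u v → Walk S v w → Walk S u w

  walkEdges : ∀ {S u v} → Walk S u v → List (Fin m)
  walkEdges []              = []
  walkEdges (step e _ _ p)  = e ∷ walkEdges p

  -- vertices visited after the start vertex (for a closed walk, each
  -- vertex of the cycle appears exactly once iff this list is Unique)
  walkVerts : ∀ {S u v} → Walk S u v → List (Fin n)
  walkVerts []                       = []
  walkVerts (step {v = v} e _ _ p)   = v ∷ walkVerts p

  ConnectedE : EdgeSet → Set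
  ConnectedE S = ∀ u v → Walk S u v

  Cycle : EdgeSet → Set
  Cycle S = Σ (Fin n) λ v → Σ (Walk S v v) λ p →
              (length (walkEdges p) ≥ 1) × Unique (walkEdges p) × Unique (walkVerts p)

  Acyclic : EdgeSet → Set
  Acyclic S = ¬ Cycle S

  SpanningTree : EdgeSet → Set
  SpanningTree S = ConnectedE S × Acyclic S

  -- number of ends of an edge at v (0 or 1, since G is loopless)
  inc : Fin n → Fin n × Fin n → ℕ
  inc v (a , b) = if does (v ≟ a) ∨ does (v ≟ b) then 1 else 0

  degIn : EdgeSet → Fin n → ℕ
  degIn S v = sum (map (λ e → if S e then inc v (ends G e) else 0) (allFin m))

  deg : Fin n → ℕ
  deg = degIn allEdges

  Δ : ℕ
  Δ = foldr _⊔_ 0 (map deg (allFin n))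

  Connected : Set
  Connected = ConnectedE allEdges

  Regular : Set
  Regular = ∀ u v → deg u ≡ deg v

  -- c : Fin n → Bool is a proper 2-colouring (ordered bipartition) of the
  -- spanning subgraph with edge set S; false = type-0 (X), true = type-1 (Y)
  ProperOn : EdgeSet → (Fin n → Bool) → Set
  ProperOn S c = ∀ e → S e ≡ true → ¬ (c (proj₁ (ends G e)) ≡ c (proj₂ (ends G e)))

  Bipartite : Set
  Bipartite = Σ (Fin n → Bool) λ c → ProperOn allEdges c

  RegularBipartite : Set
  RegularBipartite = Regular × Bipartite

  Leaf : EdgeSet → Fin n → Set
  Leaf S v = degIn S v ≡ 1

  WeaklyEven : EdgeSet → (Fin n → Bool) → Set
  WeaklyEven S c = ∀ v → Leaf S v → deg v ≡ Δ → c v ≡ false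

  -- S is a spanning weakly even (w,l)-tree: a spanning tree whose
  -- (w,l)-bipartition c (the proper 2-colouring of the tree with c w = l,
  -- unique since the tree is connected) makes it weakly even.
  SpanningWeaklyEvenTree : Fin n → Bool → EdgeSet → Set
  SpanningWeaklyEvenTree w l S =
    SpanningTree S × Σ (Fin n → Bool) λ c → ProperOn S c × (c w ≡ l) × WeaklyEven S c

{-# OPTIONS --safe #-}
module Submission where

-- Grow an independent set Y whose incident edges form a connected spanning
-- subgraph H, starting from w or from a neighbour of w so that w gets the
-- required type; Y will be the type-1 part. Counting the edges at a set Z of
-- vertices of degree Δ in Y gives |N(Z)| ≥ |Z|, with equality only if
-- Z ∪ N(Z) is a regular bipartite component; hence |N(Z)| > |Z|, and by Hall's
-- theorem, for every x the vertices of degree Δ in Y can be matched into their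
-- neighbours so as to avoid x. Now grow a rooted spanning tree of H, keeping a
-- matching of the vertices of degree Δ outside the tree into the other
-- vertices outside it: such a vertex enters together with its mate, which
-- becomes its child. When only a vertex x outside Y can enter, rematch so as
-- to avoid x. In the end every vertex of degree Δ in Y has a parent and a
-- child, so it is not a leaf.

open import Defs
open import Data.Bool using (Bool; true; false; if_then_else_)
open import Data.Empty using (⊥-elim)
open import Data.Fin using (Fin; zero; suc; _≟_)
open import Data.Fin.Properties using (any?)
open import Data.Fin.Subset using (Subset; _∈_; _∉_; _⊆_; _⊂_; _∪_; ⁅_⁆; ⊥)
open import Data.Fin.Subset.Induction using (⊃-wellFounded; Acc; acc)
open import Data.Fin.Subset.Properties
  using (_∈?_; x∈⁅x⁆; x∈⁅y⁆⇒x≡y; x∈p∪q⁻; x∈p∪q⁺; ∉⊥)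
open import Data.List using (List; []; _∷_; map; foldr; allFin; tabulate; length)
import Data.List.Membership.Propositional as L
open import Data.List.Membership.Propositional.Properties using (∈-allFin)
open import Data.List.Properties using (map-tabulate)
open import Data.List.Relation.Unary.All using (All; lookup)
open import Data.List.Relation.Unary.AllPairs using (_∷_)
open import Data.List.Relation.Unary.Any using (here; there)
open import Data.List.Relation.Unary.Unique.Propositional using (Unique)
open import Data.Nat as ℕ using (ℕ; zero; suc; _+_; _≤_; _<_; z≤n; s≤s; _⊔_)
open import Data.Nat.ListAction using () renaming (sum to sumᴸ)
open import Data.Nat.Properties hiding (_≟_)
open import Algebra.Properties.CommutativeMonoid.Sum +-0-commutativeMonoid
  using (sum; sum-cong-≗; ∑-comm)
open import Data.Product using (Σ; ∃; _×_; _,_; proj₁; proj₂)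
open import Data.Product.Properties using (≡-dec)
open import Data.Sum using (_⊎_; inj₁; inj₂; swap)
open import Data.Vec.Functional using (updateAt)
open import Data.Vec.Functional.Properties using (updateAt-updates; updateAt-minimal)
open import Function using (_∘_; const; id)
open import Relation.Binary.Construct.Closure.ReflexiveTransitive as Star
  using (Star; ε; _◅_; _◅◅_)
open import Relation.Binary.PropositionalEquality
  using (_≡_; _≢_; refl; sym; trans; cong; cong₂; subst)
open import Relation.Nullary using (¬_; Dec; yes; no; does; contradiction; ¬?)
open import Relation.Nullary.Decidable
  using (_×-dec_; _⊎-dec_; decidable-stable; dec-true; dec-false)
open import Relation.Unary using (Decidable)

private variable
  n m : ℕ
  A : Set

-- Finite subsets and Hall's theorem

infixl 6 _⊕_
_⊕_ : Subset n → Fin n → Subset n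
p ⊕ x = p ∪ ⁅ x ⁆

∈⊕-old : ∀ {p : Subset n} {x v} → v ∈ p → v ∈ p ⊕ x
∈⊕-old = x∈p∪q⁺ ∘ inj₁

∈⊕-new : ∀ {p : Subset n} {x} → x ∈ p ⊕ x
∈⊕-new = x∈p∪q⁺ (inj₂ (x∈⁅x⁆ _))

∈⊕⁻ : ∀ {p : Subset n} {x v} → v ∈ p ⊕ x → v ∈ p ⊎ v ≡ x
∈⊕⁻ {p = p} {x} v∈ with x∈p∪q⁻ p ⁅ x ⁆ v∈
... | inj₁ v∈p = inj₁ v∈p
... | inj₂ v∈x = inj₂ (x∈⁅y⁆⇒x≡y x v∈x)

p⊂p⊕x : ∀ {p : Subset n} {x} → x ∉ p → p ⊂ p ⊕ x
p⊂p⊕x x∉p = ∈⊕-old , _ , ∈⊕-new , x∉p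

-- The iteration behind every growth argument: subsets of a finite set cannot be strictly enlarged
-- forever, so `next` must at some point return an `A`.
saturate : {I : Subset n → Set} → (∀ p → I p → A ⊎ ∃ λ q → p ⊂ q × I q) →
  ∀ p → I p → A
saturate {A = A} {I} next p = go p (⊃-wellFounded p)
  where
  go : ∀ p → Acc (λ q p → p ⊂ q) p → I p → A
  go p (acc rec) i with next p i
  ... | inj₁ a           = a
  ... | inj₂ (q , p⊂q , j) = go q (rec p⊂q) j

_[_≔_] : (Fin n → A) → Fin n → A → Fin n → A
f [ x ≔ a ] = updateAt f x (const a)

≔-new : ∀ (f : Fin n → A) x {a} → (f [ x ≔ a ]) x ≡ a
≔-new f x = updateAt-updates x f

≔-old : ∀ (f : Fin n → A) {x a v} → v ≢ x → (f [ x ≔ a ]) v ≡ f v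
≔-old f {x} {v = v} v≢x = updateAt-minimal v x f v≢x

-- `mate` is a total function; its values outside `P` carry no information.
record Matching (R : Fin n → Fin n → Set) (P : Fin n → Set) : Set where
  field
    mate    : Fin n → Fin n
    related : ∀ {v} → P v → R v (mate v)
    inj     : ∀ {u v} → P u → P v → mate u ≡ mate v → u ≡ v
open Matching

weaken : ∀ {R R′ : Fin n → Fin n → Set} {P P′ : Fin n → Set} →
  (∀ {u v} → R u v → R′ u v) → (∀ {v} → P′ v → P v) → Matching R P → Matching R′ P′
weaken R⊆ P⊇ M = record
  { mate = mate M ; related = R⊆ ∘ related M ∘ P⊇ ; inj = λ u∈ v∈ → inj M (P⊇ u∈) (P⊇ v∈) }

-- R(Z) is covered by the image of Z minus one point, so |R(Z)| < |Z|.
record Deficient (R : Fin n → Fin n → Set) (Z : Subset n) : Set where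
  field
    {spare} : Fin n
    spare∈  : spare ∈ Z
    cover   : Fin n → Fin n
    covers  : ∀ {z v} → z ∈ Z → R z v → ∃ λ u → u ∈ Z × u ≢ spare × cover u ≡ v

module Hall {R : Fin n → Fin n → Set} (R? : ∀ u v → Dec (R u v)) where

  -- The matching M of p moved along an alternating path from y to z: it is
  -- defined on p ⊕ y except at z.
  record Shifted (p : Subset n) (M : Matching R (_∈ p)) (y : Fin n)
                 (Z : Subset n) (z : Fin n) : Set where
    field
      shifted  : Matching R (λ v → v ∈ p ⊕ y × v ≢ z)
      image    : ∀ {v} → v ∈ p ⊕ y → v ≢ z → ∃ λ u → u ∈ p × mate M u ≡ mate shifted v
      agrees   : ∀ {v} → v ∉ Z → mate shifted v ≡ mate M v
  open Shifted

  -- Search along alternating paths from `y`: the set `Z` of vertices reached grows until some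
  -- neighbour of it is unmatched, or all its neighbours are mates of members other than `y`.
  augment : ∀ {p y} → y ∉ p → Matching R (_∈ p) →
    Matching R (_∈ p ⊕ y) ⊎ ∃ λ Z → Z ⊆ p ⊕ y × Deficient R Z
  augment {p} {y} y∉p M = saturate {I = Inv} next ⁅ y ⁆ start
    where
    Inv : Subset n → Set
    -- Any member of `Z` can be left unmatched in place of `y`.
    Inv Z = y ∈ Z × Z ⊆ p ⊕ y × (∀ {z} → z ∈ Z → Shifted p M y Z z)

    start : Inv ⁅ y ⁆
    start = x∈⁅x⁆ y , (λ v∈ → subst (_∈ p ⊕ y) (sym (x∈⁅y⁆⇒x≡y y v∈)) (∈⊕-new {p = p})) , shift
      where
      in-p : ∀ {v} → v ∈ p ⊕ y × v ≢ y → v ∈ p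
      in-p (v∈ , v≢y) with ∈⊕⁻ v∈
      ... | inj₁ v∈p = v∈p
      ... | inj₂ v≡y = contradiction v≡y v≢y
      shift : ∀ {z} → z ∈ ⁅ y ⁆ → Shifted p M y ⁅ y ⁆ z
      shift z∈ with refl ← x∈⁅y⁆⇒x≡y y z∈ = record
        { shifted = weaken id in-p M
        ; image = λ v∈ v≢ → _ , in-p (v∈ , v≢) , refl
        ; agrees = λ _ → refl }

    module _ {Z} (y∈Z : y ∈ Z) (Z⊆ : Z ⊆ p ⊕ y) (sh : ∀ {z} → z ∈ Z → Shifted p M y Z z)
             {z v} (z∈Z : z ∈ Z) (zRv : R z v) where
      private
        N = shifted (sh z∈Z)
        f = mate N [ z ≔ v ]

        related-f : ∀ {u} → u ∈ p ⊕ y → R u (f u)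
        related-f {u} u∈ with u ≟ z
        ... | yes refl = subst (R z) (sym (≔-new (mate N) z)) zRv
        ... | no u≢z   = subst (R u) (sym (≔-old (mate N) u≢z)) (related N (u∈ , u≢z))

        -- The domain `P` varies because this serves twice: on all of `p ⊕ y` when `v` is free, and
        -- with the old owner of `v` removed when it is not.
        inj-f : ∀ {P : Fin n → Set} → (∀ {u} → P u → u ∈ p ⊕ y) →
          (∀ {u} → P u → u ≢ z → mate N u ≢ v) →
          ∀ {u w} → P u → P w → f u ≡ f w → u ≡ w
        inj-f P⊆ free {u} {w} Pu Pw eq with u ≟ z | w ≟ z
        ... | yes refl | yes refl = refl
        ... | yes refl | no w≢z = contradiction
          (trans (sym (≔-old (mate N) w≢z)) (trans (sym eq) (≔-new (mate N) z))) (free Pw w≢z)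
        ... | no u≢z | yes refl = contradiction
          (trans (sym (≔-old (mate N) u≢z)) (trans eq (≔-new (mate N) z))) (free Pu u≢z)
        ... | no u≢z | no w≢z = inj N (P⊆ Pu , u≢z) (P⊆ Pw , w≢z)
          (trans (sym (≔-old (mate N) u≢z)) (trans eq (≔-old (mate N) w≢z)))

      -- Shifting uses only mates already used by `M`, so `v` is still free and can go to `z`.
      complete : ¬ (∃ λ u → u ∈ p × mate M u ≡ v) → Matching R (_∈ p ⊕ y)
      complete free = record
        { mate = f
        ; related = related-f
        ; inj = inj-f id (λ u∈ u≢z eq → let (w , w∈p , e) = image (sh z∈Z) u∈ u≢z in
                         free (w , w∈p , trans e eq)) }

      -- The owner `u` of `v` lies outside `Z`, so it still owns `v` after the shift to `z`; handing
      -- `v` to `z` exposes `u` instead.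
      extend : ∀ {u} → u ∈ p → mate M u ≡ v → u ∉ Z → Inv (Z ⊕ u)
      extend {u} u∈p Mu≡v u∉Z = ∈⊕-old y∈Z , sub , shift
        where
        u≢z : u ≢ z
        u≢z refl = u∉Z z∈Z
        Nu≡v : mate N u ≡ v
        Nu≡v = trans (agrees (sh z∈Z) u∉Z) Mu≡v
        sub : Z ⊕ u ⊆ p ⊕ y
        sub w∈ with ∈⊕⁻ w∈
        ... | inj₁ w∈Z  = Z⊆ w∈Z
        ... | inj₂ refl = ∈⊕-old u∈p
        image-f : ∀ {w} → w ∈ p ⊕ y → w ≢ u → ∃ λ t → t ∈ p × mate M t ≡ f w
        image-f {w} w∈ w≢u with w ≟ z
        ... | yes refl = u , u∈p , trans Mu≡v (sym (≔-new (mate N) z))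
        ... | no w≢z with image (sh z∈Z) w∈ w≢z
        ...   | t , t∈p , e = t , t∈p , trans e (sym (≔-old (mate N) w≢z))
        shift : ∀ {w} → w ∈ Z ⊕ u → Shifted p M y (Z ⊕ u) w
        shift w∈ with ∈⊕⁻ w∈
        ... | inj₁ w∈Z = record
          { shifted = shifted (sh w∈Z) ; image = image (sh w∈Z)
          ; agrees = λ t∉ → agrees (sh w∈Z) (t∉ ∘ ∈⊕-old) }
        ... | inj₂ refl = record
          { shifted = record
            { mate = f
            ; related = related-f ∘ proj₁
            ; inj = inj-f proj₁ λ (t∈ , t≢u) t≢z Nt≡v →
                t≢u (inj N (t∈ , t≢z) (∈⊕-old u∈p , u≢z) (trans Nt≡v (sym Nu≡v))) }
          ; image = image-f
          ; agrees = λ {t} t∉ → trans (≔-old (mate N) λ { refl → t∉ (∈⊕-old z∈Z) })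
                                  (agrees (sh z∈Z) (t∉ ∘ ∈⊕-old)) }

    next : ∀ Z → Inv Z → (Matching R (_∈ p ⊕ y) ⊎ ∃ λ Z → Z ⊆ p ⊕ y × Deficient R Z)
                         ⊎ ∃ λ Z′ → Z ⊂ Z′ × Inv Z′
    next Z (y∈Z , Z⊆ , sh)
      with any? (λ z → any? (λ v → (z ∈? Z) ×-dec R? z v ×-dec ¬? (covered? v)))
      where
      covered? : ∀ v → Dec (∃ λ u → u ∈ Z × u ≢ y × mate M u ≡ v)
      covered? v = any? (λ u → (u ∈? Z) ×-dec ¬? (u ≟ y) ×-dec (mate M u ≟ v))
    -- The search is stuck: `M` restricted to `Z` without `y` already covers all neighbours of `Z`.
    ... | no none = inj₁ (inj₂ (Z , Z⊆ , record
      { spare∈ = y∈Z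
      ; cover = mate M
      ; covers = λ {z} {v} z∈Z zRv → decidable-stable
          (any? (λ u → (u ∈? Z) ×-dec ¬? (u ≟ y) ×-dec (mate M u ≟ v)))
          λ unc → none (z , v , z∈Z , zRv , unc) }))
    ... | yes (z , v , z∈Z , zRv , unc)
      with any? (λ u → (u ∈? p) ×-dec (mate M u ≟ v))
    ...   | no free = inj₁ (inj₁ (complete y∈Z Z⊆ sh z∈Z zRv free))
    ...   | yes (u , u∈p , Mu≡v) = inj₂ (Z ⊕ u , p⊂p⊕x u∉Z , extend y∈Z Z⊆ sh z∈Z zRv u∈p Mu≡v u∉Z)
      where
      u∉Z : u ∉ Z
      u∉Z u∈Z = unc (u , u∈Z , (λ { refl → y∉p u∈p }) , Mu≡v)

  -- The matched set grows one vertex at a time; a failed augmentation would exhibit a deficient set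
  -- inside `P`.
  hall : {P : Fin n → Set} → Decidable P →
    (∀ {Z} → (∀ {z} → z ∈ Z → P z) → ¬ Deficient R Z) → Matching R P
  hall {P} P? expanding = saturate {I = Inv} next ⊥ start
    where
    Inv : Subset n → Set
    Inv p = (∀ {v} → v ∈ p → P v) × Matching R (_∈ p)
    start : Inv ⊥
    start = (λ v∈ → ⊥-elim (∉⊥ v∈)) , record
      { mate = id ; related = λ v∈ → ⊥-elim (∉⊥ v∈) ; inj = λ v∈ → ⊥-elim (∉⊥ v∈) }
    next : ∀ p → Inv p → Matching R P ⊎ ∃ λ q → p ⊂ q × Inv q
    next p (p⊆P , M) with any? (λ y → P? y ×-dec ¬? (y ∈? p))
    ... | no none = inj₁ (weaken id in-p M)
      where
      in-p : ∀ {v} → P v → v ∈ p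
      in-p {v} Pv = decidable-stable (v ∈? p) λ v∉p → none (v , Pv , v∉p)
    ... | yes (y , Py , y∉p) = extended (augment y∉p M)
      where
      q⊆P : ∀ {v} → v ∈ p ⊕ y → P v
      q⊆P v∈ with ∈⊕⁻ v∈
      ... | inj₁ v∈p  = p⊆P v∈p
      ... | inj₂ refl = Py
      extended : Matching R (_∈ p ⊕ y) ⊎ (∃ λ Z → Z ⊆ p ⊕ y × Deficient R Z) →
        Matching R P ⊎ ∃ λ q → p ⊂ q × Inv q
      extended (inj₁ M′) = inj₂ (p ⊕ y , p⊂p⊕x y∉p , q⊆P , M′)
      extended (inj₂ (Z , Z⊆ , deficient)) = ⊥-elim (expanding (q⊆P ∘ Z⊆) deficient)

-- Double counting the edges at an independent set

∑-mono : {f g : Fin n → ℕ} → (∀ i → f i ≤ g i) → sum f ≤ sum g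
∑-mono {zero}  f≤g = z≤n
∑-mono {suc n} f≤g = +-mono-≤ (f≤g zero) (∑-mono (f≤g ∘ suc))

∑-mono-≡ : {f g : Fin n → ℕ} → (∀ i → f i ≤ g i) → sum g ≤ sum f → ∀ i → f i ≡ g i
∑-mono-≡ {f = f} {g} f≤g ∑g≤∑f zero = ≤-antisym (f≤g zero)
  (+-cancelʳ-≤ (sum (g ∘ suc)) (g zero) (f zero)
    (≤-trans ∑g≤∑f (+-monoʳ-≤ (f zero) (∑-mono (f≤g ∘ suc)))))
∑-mono-≡ {f = f} {g} f≤g ∑g≤∑f (suc i) = ∑-mono-≡ (f≤g ∘ suc)
  (+-cancelˡ-≤ (g zero) (sum (g ∘ suc)) (sum (f ∘ suc))
    (≤-trans ∑g≤∑f (+-monoˡ-≤ (sum (f ∘ suc)) (f≤g zero)))) i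

term≤∑ : (f : Fin n → ℕ) → ∀ i → f i ≤ sum f
term≤∑ f zero    = m≤m+n _ _
term≤∑ f (suc i) = ≤-trans (term≤∑ (f ∘ suc) i) (m≤n+m _ _)

two-terms≤∑ : (f : Fin n → ℕ) → ∀ {i j} → i ≢ j → f i + f j ≤ sum f
two-terms≤∑ f {zero}  {zero}  i≢j = contradiction refl i≢j
two-terms≤∑ f {zero}  {suc j} i≢j = +-monoʳ-≤ (f zero) (term≤∑ (f ∘ suc) j)
two-terms≤∑ f {suc i} {zero}  i≢j =
  ≤-trans (≤-reflexive (+-comm (f (suc i)) _)) (+-monoʳ-≤ (f zero) (term≤∑ (f ∘ suc) i))
two-terms≤∑ f {suc i} {suc j} i≢j =
  ≤-trans (two-terms≤∑ (f ∘ suc) (i≢j ∘ cong suc)) (m≤n+m _ _)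

∑-zero : {f : Fin n → ℕ} → (∀ i → f i ≡ 0) → sum f ≡ 0
∑-zero {zero}  f≡0 = refl
∑-zero {suc n} f≡0 = cong₂ _+_ (f≡0 zero) (∑-zero (f≡0 ∘ suc))

∑-single : (f : Fin n → ℕ) → ∀ i → (∀ {j} → j ≢ i → f j ≡ 0) → sum f ≡ f i
∑-single f zero    rest = trans (cong (f zero +_) (∑-zero λ j → rest {suc j} λ ())) (+-identityʳ _)
∑-single f (suc i) rest = cong₂ _+_ (rest λ ())
  (∑-single (f ∘ suc) i λ j≢i → rest λ { refl → j≢i refl })

sumᴸ-allFin : (f : Fin n → ℕ) → sumᴸ (map f (allFin n)) ≡ sum f
sumᴸ-allFin f = trans (cong sumᴸ (map-tabulate id f)) (sumᴸ-tabulate f)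
  where
  sumᴸ-tabulate : ∀ {n} (f : Fin n → ℕ) → sumᴸ (tabulate f) ≡ sum f
  sumᴸ-tabulate {zero}  f = refl
  sumᴸ-tabulate {suc n} f = cong (f zero +_) (sumᴸ-tabulate (f ∘ suc))

∈⇒≤max : (f : A → ℕ) → ∀ {x xs} → x L.∈ xs → f x ≤ foldr _⊔_ 0 (map f xs)
∈⇒≤max f (here refl) = m≤m⊔n _ _
∈⇒≤max f {xs = y ∷ _} (there x∈) = ≤-trans (∈⇒≤max f x∈) (m≤n⊔m (f y) _)

max≤ : (f : A → ℕ) → ∀ {k} → (∀ x → f x ≤ k) → ∀ xs → foldr _⊔_ 0 (map f xs) ≤ k
max≤ f f≤k []       = z≤n
max≤ f f≤k (x ∷ xs) = ⊔-lub (f≤k x) (max≤ f f≤k xs)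

-- Supplies the boundary edge along which sets and trees are extended.
crossing : {R : Fin n → Fin n → Set} {P : Fin n → Set} → Decidable P →
  ∀ {u v} → Star R u v → P u → ¬ P v → ∃ λ a → ∃ λ b → P a × ¬ P b × R a b
crossing P? ε Pu ¬Pv = contradiction Pu ¬Pv
crossing P? (_◅_ {j = j} r rs) Pu ¬Pv with P? j
... | yes Pj = crossing P? rs Pj ¬Pv
... | no ¬Pj = _ , _ , Pu , ¬Pj , r

-- Adjacency, incidence and degrees

module _ (G : Graph n m) where

  Adj : Fin n → Fin n → Set
  Adj u v = ∃ λ e → Joins G e u v

  joins-sym : ∀ {e u v} → Joins G e u v → Joins G e v u
  joins-sym = swap

  adj-sym : ∀ {u v} → Adj u v → Adj v u
  adj-sym (e , j) = e , swap j

  adj? : ∀ u v → Dec (Adj u v)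
  adj? u v = any? λ e → ≡-dec _≟_ _≟_ (ends G e) (u , v) ⊎-dec ≡-dec _≟_ _≟_ (ends G e) (v , u)

  adj-irrefl : ∀ {v} → ¬ Adj v v
  adj-irrefl (e , inj₁ eq) = loopless G e (trans (cong proj₁ eq) (sym (cong proj₂ eq)))
  adj-irrefl (e , inj₂ eq) = loopless G e (trans (cong proj₁ eq) (sym (cong proj₂ eq)))

  joins-unique : ∀ {e a b c d} → Joins G e a b → Joins G e c d →
    (a ≡ c × b ≡ d) ⊎ (a ≡ d × b ≡ c)
  joins-unique (inj₁ p) (inj₁ q) with refl ← trans (sym p) q = inj₁ (refl , refl)
  joins-unique (inj₁ p) (inj₂ q) with refl ← trans (sym p) q = inj₂ (refl , refl)
  joins-unique (inj₂ p) (inj₁ q) with refl ← trans (sym p) q = inj₂ (refl , refl)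
  joins-unique (inj₂ p) (inj₂ q) with refl ← trans (sym p) q = inj₁ (refl , refl)

  walk⇒star : ∀ {S u v} → Walk G S u v → Star Adj u v
  walk⇒star []             = ε
  walk⇒star (step e _ j p) = (e , j) ◅ walk⇒star p

  inc-end : ∀ {e u v} → Joins G e u v → inc G u (ends G e) ≡ 1
  inc-end {u = u} {v} (inj₁ eq) rewrite eq with u ≟ u
  ... | yes _  = refl
  ... | no u≢u = contradiction refl u≢u
  inc-end {u = u} {v} (inj₂ eq) rewrite eq with u ≟ v | u ≟ u
  ... | yes _ | _      = refl
  ... | no _  | yes _  = refl
  ... | no _  | no u≢u = contradiction refl u≢u

  inc-other : ∀ {e u v w} → Joins G e u v → w ≢ u → w ≢ v → inc G w (ends G e) ≡ 0
  inc-other {u = u} {v} {w} (inj₁ eq) w≢u w≢v rewrite eq with w ≟ u | w ≟ v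
  ... | yes w≡u | _       = contradiction w≡u w≢u
  ... | no _    | yes w≡v = contradiction w≡v w≢v
  ... | no _    | no _    = refl
  inc-other {u = u} {v} {w} (inj₂ eq) w≢u w≢v rewrite eq with w ≟ v | w ≟ u
  ... | yes w≡v | _       = contradiction w≡v w≢v
  ... | no _    | yes w≡u = contradiction w≡u w≢u
  ... | no _    | no _    = refl

  joins-ends : ∀ e → Joins G e (proj₁ (ends G e)) (proj₂ (ends G e))
  joins-ends e = inj₁ refl

  deg-∑ : ∀ v → deg G v ≡ sum (λ e → inc G v (ends G e))
  deg-∑ v = sumᴸ-allFin (λ e → inc G v (ends G e))

  deg≤Δ : ∀ v → deg G v ≤ Δ G
  deg≤Δ v = ∈⇒≤max (deg G) (∈-allFin v)

  Independent : Subset n → Set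
  Independent Z = ∀ u v → u ∈ Z → v ∈ Z → ¬ Adj u v

  -- Double count the edges at Z: since they all end in ν(Z), there are at most
  -- ∑ deg (ν z) ≤ ∑ Δ = ∑ deg z of them, so both inequalities are equalities
  -- and Z ∪ ν(Z) is a regular bipartite component.
  module _ (connected : Connected G) {Z : Subset n} (indep : Independent Z)
           (deg≡Δ : ∀ {z} → z ∈ Z → deg G z ≡ Δ G) (ν : Fin n → Fin n)
           (covers : ∀ {z v} → z ∈ Z → Adj z v → ∃ λ u → u ∈ Z × ν u ≡ v) where
    private
      -- Incidences are indexed by `Z`, not by its image: where `ν` repeats a value, an edge there
      -- is counted once for each preimage.
      count : (Fin n → Fin n) → Fin n → Fin m → ℕ
      count h z e = if does (z ∈? Z) then inc G (h z) (ends G e) else 0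

      from to : Fin n → Fin m → ℕ
      from = count id
      to   = count ν

      count-∈ : ∀ h {z} → z ∈ Z → ∀ e → count h z e ≡ inc G (h z) (ends G e)
      count-∈ h {z} z∈ e with z ∈? Z
      ... | yes _ = refl
      ... | no z∉ = contradiction z∈ z∉

      ∑count : ∀ h {z} → z ∈ Z → sum (count h z) ≡ deg G (h z)
      ∑count h {z} z∈ = trans (sum-cong-≗ (count-∈ h z∈)) (sym (deg-∑ (h z)))

      to≤from : ∀ z → sum (to z) ≤ sum (from z)
      to≤from z with z ∈? Z in eq
      ... | no _ = ≤-refl
      ... | yes z∈ = ≤-trans (≤-reflexive (sym (deg-∑ (ν z)))) (≤-trans (deg≤Δ (ν z))
          (≤-reflexive (trans (sym (deg≡Δ z∈)) (deg-∑ z))))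

      into out : Fin m → ℕ
      out e  = sum λ z → from z e
      into e = sum λ z → to z e

      -- By independence such an edge has only one end in `Z`.
      out-touching : ∀ {e p q} → Joins G e p q → p ∈ Z → out e ≡ 1
      out-touching {e} {p} {q} j p∈ =
        trans (∑-single _ p others) (trans (count-∈ id p∈ e) (inc-end j))
        where
        others : ∀ {z} → z ≢ p → from z e ≡ 0
        others {z} z≢p with z ∈? Z
        ... | no _ = refl
        ... | yes z∈ = inc-other j z≢p λ { refl → indep _ _ p∈ z∈ (e , j) }

      out-avoiding : ∀ {e p q} → Joins G e p q → p ∉ Z → q ∉ Z → out e ≡ 0
      out-avoiding {e} {p} {q} j p∉ q∉ = ∑-zero zeros
        where
        zeros : ∀ z → from z e ≡ 0
        zeros z with z ∈? Z
        ... | no _ = refl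
        ... | yes z∈ = inc-other {w = z} j (λ { refl → p∉ z∈ }) (λ { refl → q∉ z∈ })

      into-touching : ∀ {e z w} → z ∈ Z → Joins G e (ν z) w → 1 ≤ into e
      into-touching {e} {z} z∈ j = ≤-trans
        (≤-reflexive (sym (trans (count-∈ ν z∈ e) (inc-end j)))) (term≤∑ (λ z → to z e) z)

      -- An edge at `Z` counts once in `out`, and its other end is a value of `ν`, so it counts in
      -- `into` as well; all other edges count zero in `out`.
      out≤into : ∀ e → out e ≤ into e
      out≤into e = go (joins-ends e)
        where
        touching : ∀ {p q} → Joins G e p q → p ∈ Z → out e ≤ into e
        touching j p∈ with covers p∈ (e , j)
        ... | u , u∈ , refl = ≤-trans (≤-reflexive (out-touching j p∈)) (into-touching u∈ (joins-sym j))
        go : ∀ {p q} → Joins G e p q → out e ≤ into e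
        go {p} {q} j with p ∈? Z | q ∈? Z
        ... | yes p∈ | _      = touching j p∈
        ... | no _   | yes q∈ = touching (joins-sym j) q∈
        ... | no p∉  | no q∉  = ≤-trans (≤-reflexive (out-avoiding j p∉ q∉)) z≤n

      ∑out≡∑from : sum out ≡ sum (sum ∘ from)
      ∑out≡∑from = sym (∑-comm from)

      ∑into≡∑to : sum into ≡ sum (sum ∘ to)
      ∑into≡∑to = sym (∑-comm to)

      -- Summed vertex by vertex, `into` totals at most `out`; edge by edge it is at least `out`.
      -- Hence there is no slack at any edge.
      out≡into : ∀ e → out e ≡ into e
      out≡into = ∑-mono-≡ out≤into (≤-trans (≤-reflexive ∑into≡∑to)
        (≤-trans (∑-mono to≤from) (≤-reflexive (sym ∑out≡∑from))))

      to≡from : ∀ z → sum (to z) ≡ sum (from z)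
      to≡from = ∑-mono-≡ to≤from (≤-trans (≤-reflexive (sym ∑out≡∑from))
        (≤-trans (∑-mono out≤into) (≤-reflexive ∑into≡∑to)))

      -- `into` is positive on such an edge, hence so is `out`, which vanishes on edges avoiding
      -- `Z`.
      touched : ∀ {e z w} → z ∈ Z → Joins G e (ν z) w → ν z ∈ Z ⊎ w ∈ Z
      touched {e} {z} {w} z∈ j with ν z ∈? Z | w ∈? Z
      ... | yes νz∈ | _     = inj₁ νz∈
      ... | no _    | yes w∈ = inj₂ w∈
      ... | no νz∉  | no w∉  = contradiction
        (≤-trans (into-touching z∈ j) (≤-reflexive (trans (sym (out≡into e)) (out-avoiding j νz∉ w∉)))) λ ()

      Closure : Fin n → Set
      Closure v = v ∈ Z ⊎ ∃ λ z → z ∈ Z × ν z ≡ v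

      closed : ∀ {u v} → Closure u → Star Adj u v → Closure v
      closed u∈ ε = u∈
      closed (inj₁ u∈) (a ◅ p) = closed (inj₂ (covers u∈ a)) p
      closed (inj₂ (z , z∈ , refl)) ((e , j) ◅ p) with touched z∈ j
      ... | inj₁ u∈ = closed (inj₂ (covers u∈ (e , j))) p
      ... | inj₂ v∈ = closed (inj₁ v∈) p

    -- By connectedness `Closure` is the whole vertex set, and membership in `Z` is the colouring.
    covered⇒regularBipartite : ∀ {z} → z ∈ Z → RegularBipartite G
    covered⇒regularBipartite {z₀} z₀∈ = (λ u v → trans (degΔ u) (sym (degΔ v))) , colour , proper
      where
      everywhere : ∀ v → Closure v
      everywhere v = closed (inj₁ z₀∈) (walk⇒star (connected z₀ v))
      degΔ : ∀ v → deg G v ≡ Δ G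
      degΔ v with everywhere v
      ... | inj₁ v∈ = deg≡Δ v∈
      -- Equality in `to≤from` forces degree `Δ` at `ν z` too.
      ... | inj₂ (z , z∈ , refl) =
        trans (sym (∑count ν z∈)) (trans (to≡from z) (trans (∑count id z∈) (deg≡Δ z∈)))
      colour : Fin n → Bool
      colour v = does (v ∈? Z)
      proper : ProperOn G (allEdges G) colour
      proper e _ with proj₁ (ends G e) ∈? Z | proj₂ (ends G e) ∈? Z
      ... | yes p∈ | yes q∈ = λ _ → indep _ _ p∈ q∈ (e , joins-ends e)
      ... | yes _  | no _   = λ ()
      ... | no _   | yes _  = λ ()
      ... | no p∉  | no q∉  with everywhere (proj₁ (ends G e))
      ...   | inj₁ p∈ = λ _ → p∉ p∈
      ...   | inj₂ (z , z∈ , νz≡p) with touched z∈ (subst (λ p → Joins G e p _) (sym νz≡p) (joins-ends e))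
      ...     | inj₁ νz∈ = λ _ → p∉ (subst (_∈ Z) νz≡p νz∈)
      ...     | inj₂ q∈  = λ _ → q∉ q∈

-- Spanning subgraphs and rooted trees

-- `depth` need only increase strictly away from the root; it drives the climb to the root and the
-- proof of acyclicity.
record Link (n m : ℕ) : Set where
  constructor link
  field
    edge   : Fin m
    parent : Fin n
    depth  : ℕ
open Link

module _ (G : Graph n m) where

  -- Adjacency in the spanning subgraph formed by the edges that meet `Y`.
  Touching : Subset n → Fin n → Fin n → Set
  Touching Y u v = Adj G u v × (u ∈ Y ⊎ v ∈ Y)

  -- While some vertex is at distance at least two from `Y`, a walk to it crosses to a `b` at
  -- distance exactly two. Adding `b` keeps `Y` independent, and the vertex in between joins `b` to
  -- the rest.
  spanning-independent : Connected G → ∀ y₀ →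
    ∃ λ Y → y₀ ∈ Y × Independent G Y × (∀ v → Star (Touching Y) y₀ v)
  spanning-independent connected y₀ = saturate {I = Inv} next ⁅ y₀ ⁆ start
    where
    Inv : Subset n → Set
    Inv Y = y₀ ∈ Y × Independent G Y × (∀ v → v ∈ Y → Star (Touching Y) y₀ v)

    start : Inv ⁅ y₀ ⁆
    start = x∈⁅x⁆ y₀ , indep , reach
      where
      indep : Independent G ⁅ y₀ ⁆
      indep _ _ u∈ v∈ a with refl ← x∈⁅y⁆⇒x≡y y₀ u∈ | refl ← x∈⁅y⁆⇒x≡y y₀ v∈ = adj-irrefl G a
      reach : ∀ v → v ∈ ⁅ y₀ ⁆ → Star (Touching ⁅ y₀ ⁆) y₀ v
      reach _ v∈ with refl ← x∈⁅y⁆⇒x≡y y₀ v∈ = ε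

    next : ∀ Y → Inv Y →
      (∃ λ Y → y₀ ∈ Y × Independent G Y × (∀ v → Star (Touching Y) y₀ v)) ⊎ ∃ λ Y′ → Y ⊂ Y′ × Inv Y′
    next Y (y₀∈ , indep , reach) = decide (any? (λ v → ¬? (near? v)))
      where
      Near : Fin n → Set
      Near v = v ∈ Y ⊎ ∃ λ u → u ∈ Y × Adj G u v
      near? : Decidable Near
      near? v = (v ∈? Y) ⊎-dec any? (λ u → (u ∈? Y) ×-dec adj? G u v)

      decide : Dec (∃ λ v → ¬ Near v) → _
      decide (no none) = inj₁ (Y , y₀∈ , indep , everywhere)
        where
        everywhere : ∀ v → Star (Touching Y) y₀ v
        everywhere v with decidable-stable (near? v) (λ far → none (v , far))
        ... | inj₁ v∈           = reach _ v∈
        ... | inj₂ (u , u∈ , a) = reach _ u∈ ◅◅ (a , inj₁ u∈) ◅ ε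
      decide (yes (v , far)) with crossing near? (walk⇒star G (connected y₀ v)) (inj₁ y₀∈) far
      ... | a , b , inj₁ a∈ , b-far , ab = contradiction (inj₂ (a , a∈ , ab)) b-far
      ... | a , b , inj₂ (u , u∈ , ua) , b-far , ab =
        inj₂ (Y ⊕ b , p⊂p⊕x (b-far ∘ inj₁) , ∈⊕-old y₀∈ , indep′ , reach′)
        where
        indep′ : Independent G (Y ⊕ b)
        indep′ _ _ x∈ z∈ xz with ∈⊕⁻ x∈ | ∈⊕⁻ z∈
        ... | inj₁ x∈Y  | inj₁ z∈Y  = indep _ _ x∈Y z∈Y xz
        ... | inj₁ x∈Y  | inj₂ refl = b-far (inj₂ (_ , x∈Y , xz))
        ... | inj₂ refl | inj₁ z∈Y  = b-far (inj₂ (_ , z∈Y , adj-sym G xz))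
        ... | inj₂ refl | inj₂ refl = adj-irrefl G xz
        grow : ∀ {x z} → Touching Y x z → Touching (Y ⊕ b) x z
        grow (xz , inj₁ x∈) = xz , inj₁ (∈⊕-old x∈)
        grow (xz , inj₂ z∈) = xz , inj₂ (∈⊕-old z∈)
        reach′ : ∀ x → x ∈ Y ⊕ b → Star (Touching (Y ⊕ b)) y₀ x
        reach′ _ x∈ with ∈⊕⁻ x∈
        ... | inj₁ x∈Y  = Star.map grow (reach _ x∈Y)
        ... | inj₂ refl = Star.map grow (reach _ u∈) ◅◅ (ua , inj₁ (∈⊕-old u∈)) ◅ (ab , inj₂ (∈⊕-new {p = Y})) ◅ ε

  -- Rooted trees with recorded children

  module _ (Y : Subset n) (r : Fin n) where

    -- `R` is the vertex set; `K` collects vertices certified to have a child. Links of vertices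
    -- outside `R` carry no information.
    record Tree (R K : Subset n) : Set where
      field
        node  : Fin n → Link n m
        root∈ : r ∈ R
      Linked : Fin n → Link n m → Set
      Linked v (link e u d) =
        Joins G e u v × u ∈ R × depth (node u) < d × (u ∈ Y ⊎ v ∈ Y)
      field
        linked : ∀ {v} → v ∈ R → v ≢ r → Linked v (node v)
        child  : ∀ {v} → v ∈ K → ∃ λ c → c ∈ R × c ≢ r × parent (node c) ≡ v

    -- The edge `e` is a placeholder: of the link at the root only the depth is ever read.
    singleton : Fin m → Tree ⁅ r ⁆ ⊥
    singleton e = record
      { node = λ _ → link e r 0
      ; root∈ = x∈⁅x⁆ r
      ; linked = λ v∈ v≢r → contradiction (x∈⁅y⁆⇒x≡y r v∈) v≢r
      ; child = λ v∈ → ⊥-elim (∉⊥ v∈) }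

    attach : ∀ {R K u v} → Tree R K → u ∈ R → v ∉ R → Touching Y u v → Tree (R ⊕ v) (K ⊕ u)
    attach {R} {K} {u} {v} T u∈ v∉ ((e , j) , touch) = record
      { node = node′ ; root∈ = ∈⊕-old root∈ ; linked = linked′ ; child = child′ }
      where
      open Tree T
      new : Link n m
      new = link e u (suc (depth (node u)))
      node′ : Fin n → Link n m
      node′ = node [ v ≔ new ]
      node-old : ∀ {x} → x ∈ R → node′ x ≡ node x
      node-old x∈ = ≔-old node λ { refl → v∉ x∈ }
      linked′ : ∀ {x} → x ∈ R ⊕ v → x ≢ r →
        Joins G (edge (node′ x)) (parent (node′ x)) x × parent (node′ x) ∈ R ⊕ v ×
        depth (node′ (parent (node′ x))) < depth (node′ x) × (parent (node′ x) ∈ Y ⊎ x ∈ Y)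
      linked′ {x} x∈ x≢r with ∈⊕⁻ x∈
      ... | inj₁ x∈R with linked x∈R x≢r
      ...   | jx , p∈ , p<x , t rewrite node-old x∈R | node-old p∈ = jx , ∈⊕-old p∈ , p<x , t
      linked′ {x} x∈ x≢r | inj₂ refl
        rewrite ≔-new node v {new} | node-old u∈ = j , ∈⊕-old u∈ , ≤-refl , touch
      child′ : ∀ {x} → x ∈ K ⊕ u → ∃ λ c → c ∈ R ⊕ v × c ≢ r × parent (node′ c) ≡ x
      child′ x∈ with ∈⊕⁻ x∈
      ... | inj₁ x∈K with child x∈K
      ...   | c , c∈ , c≢r , eq = c , ∈⊕-old c∈ , c≢r , trans (cong parent (node-old c∈)) eq
      child′ x∈ | inj₂ refl =
        v , ∈⊕-new {p = R} , (λ { refl → v∉ root∈ }) , cong parent (≔-new node v)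

open Deficient
open Tree

module _ (G : Graph n m) where

  walk-++ : ∀ {S u v w} → Walk G S u v → Walk G S v w → Walk G S u w
  walk-++ []             q = q
  walk-++ (step e s j p) q = step e s j (walk-++ p q)

  walk-reverse : ∀ {S u v} → Walk G S u v → Walk G S v u
  walk-reverse []             = []
  walk-reverse (step e s j p) = walk-++ (walk-reverse p) (step e s (joins-sym G j) [])

  -- Edge set, colouring and leaves of a rooted tree on all vertices

  module SpanningTreeOf {Y r R K} (T : Tree G Y r R K) (all∈ : ∀ v → v ∈ R)
                        (indep : Independent G Y) (r∉Y : r ∉ Y) where
    private
      up : Fin n → Fin m
      up v = edge (node T v)

      dad : Fin n → Fin n
      dad v = parent (node T v)

      height : Fin n → ℕ
      height v = depth (node T v)

      ParentEdge : Fin m → Fin n → Set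
      ParentEdge e v = v ≢ r × up v ≡ e

      parentEdge? : ∀ e → Dec (∃ (ParentEdge e))
      parentEdge? e = any? λ v → ¬? (v ≟ r) ×-dec (up v ≟ e)

      joins : ∀ {v} → v ≢ r → Joins G (up v) (dad v) v
      joins v≢r = proj₁ (linked T (all∈ _) v≢r)

      deeper : ∀ {v} → v ≢ r → height (dad v) < height v
      deeper v≢r = proj₁ (proj₂ (proj₂ (linked T (all∈ _) v≢r)))

    treeEdges : EdgeSet G
    treeEdges e = does (parentEdge? e)

    private
      up∈ : ∀ {v} → v ≢ r → treeEdges (up v) ≡ true
      up∈ {v} v≢r with parentEdge? (up v)
      ... | yes _   = refl
      ... | no none = contradiction (v , v≢r , refl) none

      tree⁻ : ∀ {e} → treeEdges e ≡ true → ∃ (ParentEdge e)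
      tree⁻ {e} s with parentEdge? e
      ... | yes found = found
      tree⁻ {e} () | no _

      -- `k` bounds the height and is the fuel of the recursion.
      climb : ∀ k v → height v < k → Walk G treeEdges v r
      climb (suc k) v (s≤s v<k) with v ≟ r
      ... | yes refl = []
      ... | no v≢r   = step (up v) (up∈ v≢r) (joins-sym G (joins v≢r))
                         (climb k (dad v) (≤-trans (deeper v≢r) v<k))

      to-root : ∀ v → Walk G treeEdges v r
      to-root v = climb _ v ≤-refl

      orient : ∀ {e a b} → treeEdges e ≡ true → Joins G e a b →
        (ParentEdge e b × height a < height b) ⊎ (ParentEdge e a × height b < height a)
      orient s j with tree⁻ s
      ... | v , v≢r , refl with joins-unique G (joins v≢r) j
      ...   | inj₁ (refl , refl) = inj₁ ((v≢r , refl) , deeper v≢r)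
      ...   | inj₂ (refl , refl) = inj₂ ((v≢r , refl) , deeper v≢r)

      parentEdge-unique : ∀ {e f v} → ParentEdge e v → ParentEdge f v → e ≡ f
      parentEdge-unique (_ , p) (_ , q) = trans (sym p) q

      -- Once a trail has used the parent edge of `v`, no later edge of it is a parent edge of `v`.
      avoid : ∀ {e v es} → ParentEdge e v → All (e ≢_) es → ∀ {f} → f L.∈ es → ¬ ParentEdge f v
      avoid p e∉ f∈ q = lookup e∉ f∈ (parentEdge-unique p q)

      -- A trail that leaves its first vertex downwards can never turn upwards,
      -- as it would have to reuse a parent edge.
      descending : ∀ {a b} (p : Walk G treeEdges a b) → Unique (walkEdges G p) →
        (∀ {e} → e L.∈ walkEdges G p → ¬ ParentEdge e a) →
        length (walkEdges G p) + height a ≤ height b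
      descending [] _ _ = ≤-refl
      descending (step {v = c} e s j p) (e∉ ∷ uniq) ¬up with orient s j
      ... | inj₂ (up-a , _) = contradiction up-a (¬up (here refl))
      ... | inj₁ (up-c , a<c) = ≤-trans
        (≤-trans (≤-reflexive (sym (+-suc _ _))) (+-monoʳ-≤ _ a<c))
        (descending p uniq (avoid up-c e∉))

      -- A downward step would either be the last one, along the parent edge of `b`, or force a
      -- strict descent to `b`, against the bound for the rest of the trail.
      ascending : ∀ {a b} (p : Walk G treeEdges a b) → Unique (walkEdges G p) →
        (∀ {e} → e L.∈ walkEdges G p → ¬ ParentEdge e b) → height b ≤ height a
      ascending [] _ _ = ≤-refl
      ascending (step e s j p) (e∉ ∷ uniq) ¬up with ascending p uniq (¬up ∘ there) | orient s j
      ... | b≤c | inj₂ (_ , c<a) = ≤-trans b≤c (<⇒≤ c<a)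
      ... | b≤c | inj₁ (up-c , a<c) with p | descending p uniq (avoid up-c e∉)
      ...   | []           | _   = contradiction up-c (¬up (here refl))
      ...   | step _ _ _ _ | c<b = contradiction (≤-trans (s≤s (m≤n+m _ _)) (≤-trans c<b b≤c)) (<-irrefl refl)

      -- If the first step goes down, the rest cannot come back up; if it goes up, the rest would
      -- have to return by the same parent edge.
      acyclic : Acyclic G treeEdges
      acyclic (v , step e s j p , _ , e∉ ∷ uniq , _) with orient s j
      ... | inj₁ (up-c , v<c) = <⇒≱ v<c (≤-trans (m≤n+m _ _) (descending p uniq (avoid up-c e∉)))
      ... | inj₂ (up-v , c<v) = <⇒≱ c<v (ascending p uniq (avoid up-v e∉))

    spanningTree : SpanningTree G treeEdges
    spanningTree = (λ u v → walk-++ (to-root u) (walk-reverse (to-root v))) , acyclic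

    colour : Fin n → Bool
    colour v = does (v ∈? Y)

    -- Each tree edge meets `Y`, and by independence in one end only.
    proper : ProperOn G treeEdges colour
    proper e s with tree⁻ s
    ... | v , v≢r , refl = λ same → go same (touch (joins v≢r) (proj₂ (proj₂ (proj₂ (linked T (all∈ _) v≢r)))))
      where
      p = proj₁ (ends G (up v))
      q = proj₂ (ends G (up v))
      touch : ∀ {a b} → Joins G (up v) a b → a ∈ Y ⊎ b ∈ Y → p ∈ Y ⊎ q ∈ Y
      touch j t with joins-unique G j (joins-ends G (up v))
      ... | inj₁ (refl , refl) = t
      ... | inj₂ (refl , refl) = swap t
      go : colour p ≡ colour q → p ∈ Y ⊎ q ∈ Y → _
      go same t with p ∈? Y | q ∈? Y | same | t
      ... | yes p∈ | yes q∈ | _ | _ = indep _ _ p∈ q∈ (up v , joins-ends G (up v))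
      ... | no p∉  | no q∉  | _ | inj₁ p∈ = p∉ p∈
      ... | no p∉  | no q∉  | _ | inj₂ q∈ = q∉ q∈

    -- The root is not in `Y`, so `v` has a parent edge, and the parent edge of its child is a
    -- second edge at `v`.
    not-leaf : ∀ {v} → v ∈ Y → v ∈ K → ¬ Leaf G treeEdges v
    not-leaf {v} v∈Y v∈K leaf with child T v∈K
    ... | c , _ , c≢r , refl = <⇒≱ two (≤-reflexive leaf)
      where
      v≢r : v ≢ r
      v≢r v≡r = r∉Y (subst (_∈ Y) v≡r v∈Y)
      up-c≢up-v : up c ≢ up v
      up-c≢up-v eq with joins-unique G (joins c≢r) (subst (λ e → Joins G e (dad v) v) (sym eq) (joins v≢r))
      ... | inj₁ (_ , c≡v) = <-irrefl (cong height (sym c≡v)) (deeper c≢r)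
      ... | inj₂ (_ , c≡dad) = <-irrefl refl (<-trans (deeper v≢r)
                                 (subst (λ x → height v < height x) c≡dad (deeper c≢r)))
      weight : Fin m → ℕ
      weight e = if treeEdges e then inc G v (ends G e) else 0
      weight-1 : ∀ {e u} → treeEdges e ≡ true → Joins G e v u → weight e ≡ 1
      weight-1 s j rewrite s = inc-end G j
      two : 2 ≤ degIn G treeEdges v
      two = ≤-trans
        (≤-reflexive (sym (cong₂ _+_ (weight-1 (up∈ c≢r) (joins c≢r))
                                     (weight-1 (up∈ v≢r) (joins-sym G (joins v≢r))))))
        (≤-trans (two-terms≤∑ weight up-c≢up-v) (≤-reflexive (sym (sumᴸ-allFin weight))))

  -- Growing the tree together with a matching outside it

  module _ {Y : Subset n} {r : Fin n} (indep : Independent G Y) (r∉Y : r ∉ Y)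
           (reach : ∀ v → Star (Touching G Y) r v) (e₀ : Fin m)
           {P : Fin n → Set} (P? : Decidable P) (P⊆Y : ∀ {v} → P v → v ∈ Y)
           (matching : ∀ x → Matching (λ y v → Adj G y v × v ≢ x) P) where
    private
      TreeWithChildren : Subset n → Set
      TreeWithChildren R = ∃ λ K → Tree G Y r R K × (∀ v → v ∈ R → P v → v ∈ K)

      Outside : Subset n → Set
      Outside R = Σ (Matching (Adj G) (λ v → P v × v ∉ R)) λ M →
        ∀ v → P v → v ∉ R → mate M v ∉ R

      Inv : Subset n → Set
      Inv R = TreeWithChildren R × Outside R

      independent-adj : ∀ {u v} → Adj G u v → v ∈ Y → u ∉ Y
      independent-adj a v∈ u∈ = indep _ _ u∈ v∈ a

    grow-tree : ∃ λ R → (∀ v → v ∈ R) × TreeWithChildren R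
    grow-tree = saturate {I = Inv} next ⁅ r ⁆ start
      where
      start : Inv ⁅ r ⁆
      start = (⊥ , singleton G Y r e₀ ,
                λ v v∈ Pv → contradiction (subst (_∈ Y) (x∈⁅y⁆⇒x≡y r v∈) (P⊆Y Pv)) r∉Y)
            -- Avoiding `r` keeps all mates outside the initial tree.
            , weaken proj₁ proj₁ (matching r)
            , λ v Pv _ v∈ → proj₂ (related (matching r) Pv) (x∈⁅y⁆⇒x≡y r v∈)

      next : ∀ R → Inv R → (∃ λ R → (∀ v → v ∈ R) × TreeWithChildren R) ⊎ ∃ λ R′ → R ⊂ R′ × Inv R′
      next R ((K , T , K⊇) , M , M∉) = decide (any? (λ v → ¬? (v ∈? R)))
        where
        Entering : Fin n → Fin n → Set
        Entering a b = a ∈ R × a ∉ Y × b ∉ R × b ∈ Y × Adj G a b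

        entering? : ∀ a b → Dec (Entering a b)
        entering? a b =
          (a ∈? R) ×-dec ¬? (a ∈? Y) ×-dec ¬? (b ∈? R) ×-dec (b ∈? Y) ×-dec adj? G a b

        -- The matching survives: mates of vertices in `Y` lie outside `Y`, so none of them is `b`.
        add-free : ∀ {a b} → Entering a b → ¬ P b → ∃ λ R′ → R ⊂ R′ × Inv R′
        add-free {a} {b} (a∈ , _ , b∉ , b∈Y , ab) ¬Pb = R ⊕ b , p⊂p⊕x b∉
          , (K ⊕ a , attach G Y r T a∈ b∉ (ab , inj₂ b∈Y) , children)
          , weaken id (λ (Pv , v∉) → Pv , v∉ ∘ ∈⊕-old) M , outside
          where
          children : ∀ v → v ∈ R ⊕ b → P v → v ∈ K ⊕ a
          children v v∈ Pv with ∈⊕⁻ v∈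
          ... | inj₁ v∈R  = ∈⊕-old (K⊇ v v∈R Pv)
          ... | inj₂ refl = contradiction Pv ¬Pb
          outside : ∀ v → P v → v ∉ R ⊕ b → mate M v ∉ R ⊕ b
          outside v Pv v∉ Mv∈ with ∈⊕⁻ Mv∈
          ... | inj₁ Mv∈R = M∉ v Pv (v∉ ∘ ∈⊕-old) Mv∈R
          ... | inj₂ Mv≡b = independent-adj (related M (Pv , v∉ ∘ ∈⊕-old))
                              (subst (_∈ Y) (sym Mv≡b) b∈Y) (P⊆Y Pv)

        -- The mate `c` becomes the child of `b`; injectivity of the matching keeps the other mates
        -- away from `c`.
        add-matched : ∀ {a b} → Entering a b → P b → ∃ λ R′ → R ⊂ R′ × Inv R′
        add-matched {a} {b} (a∈ , _ , b∉ , b∈Y , ab) Pb = R ⊕ b ⊕ c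
          , ((λ v∈ → ∈⊕-old (∈⊕-old v∈)) , b , ∈⊕-old (∈⊕-new {p = R}) , b∉)
          , (K ⊕ a ⊕ b
            , attach G Y r (attach G Y r T a∈ b∉ (ab , inj₂ b∈Y)) (∈⊕-new {p = R}) c∉ (bc , inj₁ b∈Y)
            , children)
          , weaken id (λ (Pv , v∉) → Pv , v∉ ∘ ∈⊕-old ∘ ∈⊕-old) M , outside
          where
          c = mate M b
          bc : Adj G b c
          bc = related M (Pb , b∉)
          c∉Y : c ∉ Y
          c∉Y c∈ = indep _ _ b∈Y c∈ bc
          c∉ : c ∉ R ⊕ b
          c∉ c∈ with ∈⊕⁻ c∈
          ... | inj₁ c∈R = M∉ b Pb b∉ c∈R
          ... | inj₂ c≡b = c∉Y (subst (_∈ Y) (sym c≡b) b∈Y)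
          children : ∀ v → v ∈ R ⊕ b ⊕ c → P v → v ∈ K ⊕ a ⊕ b
          children v v∈ Pv with ∈⊕⁻ v∈
          ... | inj₂ refl = contradiction (P⊆Y Pv) c∉Y
          ... | inj₁ v∈′ with ∈⊕⁻ v∈′
          ...   | inj₁ v∈R  = ∈⊕-old (∈⊕-old (K⊇ v v∈R Pv))
          ...   | inj₂ refl = ∈⊕-new {p = K ⊕ a}
          outside : ∀ v → P v → v ∉ R ⊕ b ⊕ c → mate M v ∉ R ⊕ b ⊕ c
          outside v Pv v∉ Mv∈ with ∈⊕⁻ Mv∈
          ... | inj₂ Mv≡c = v∉ (∈⊕-old (subst (_∈ R ⊕ b) (sym v≡b) (∈⊕-new {p = R})))
            where
            v≡b : v ≡ b
            v≡b = inj M (Pv , v∉ ∘ ∈⊕-old ∘ ∈⊕-old) (Pb , b∉) Mv≡c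
          ... | inj₁ Mv∈′ with ∈⊕⁻ Mv∈′
          ...   | inj₁ Mv∈R = M∉ v Pv (v∉ ∘ ∈⊕-old ∘ ∈⊕-old) Mv∈R
          ...   | inj₂ Mv≡b = independent-adj (related M (Pv , v∉ ∘ ∈⊕-old ∘ ∈⊕-old))
                                (subst (_∈ Y) (sym Mv≡b) b∈Y) (P⊆Y Pv)

        -- With no entering edge, vertices of `P` outside the tree have no neighbour in it, so any
        -- matching sends them outside `R`; it only has to miss the new vertex `b`.
        add-rematched : (∀ {a b} → ¬ Entering a b) → ∀ {a b} → a ∈ R → b ∉ R → Touching G Y a b →
          ∃ λ R′ → R ⊂ R′ × Inv R′
        add-rematched none {a} {b} a∈ b∉ t@(ab , ends) = R ⊕ b , p⊂p⊕x b∉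
          , (K ⊕ a , attach G Y r T a∈ b∉ t , children)
          , weaken proj₁ proj₁ (matching b) , outside
          where
          b∉Y : b ∉ Y
          b∉Y b∈Y = none (a∈ , independent-adj ab b∈Y , b∉ , b∈Y , ab)
          children : ∀ v → v ∈ R ⊕ b → P v → v ∈ K ⊕ a
          children v v∈ Pv with ∈⊕⁻ v∈
          ... | inj₁ v∈R  = ∈⊕-old (K⊇ v v∈R Pv)
          ... | inj₂ refl = contradiction (P⊆Y Pv) b∉Y
          outside : ∀ v → P v → v ∉ R ⊕ b → mate (matching b) v ∉ R ⊕ b
          outside v Pv v∉ Mv∈ with related (matching b) Pv | ∈⊕⁻ Mv∈
          ... | _  , Mv≢b | inj₂ Mv≡b = Mv≢b Mv≡b
          ... | vM , _    | inj₁ Mv∈R =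
            none (Mv∈R , independent-adj (adj-sym G vM) (P⊆Y Pv) , v∉ ∘ ∈⊕-old , P⊆Y Pv , adj-sym G vM)

        decide : Dec (∃ λ v → v ∉ R) → _
        decide (no none) = inj₁ (R , (λ v → decidable-stable (v ∈? R) (λ v∉ → none (v , v∉))) , K , T , K⊇)
        decide (yes (v , v∉)) with any? (λ a → any? (entering? a))
        ... | yes (a , b , enter) with P? b
        ...   | yes Pb = inj₂ (add-matched enter Pb)
        ...   | no ¬Pb = inj₂ (add-free enter ¬Pb)
        decide (yes (v , v∉)) | no none with crossing (_∈? R) (reach v) (root∈ T) v∉
        ... | a , b , a∈ , b∉ , t = inj₂ (add-rematched (λ enter → none (_ , _ , enter)) a∈ b∉ t)

  -- From Hall's condition to the weakly even tree

  -- A graph with one vertex has no edges, hence is regular bipartite; so another vertex exists, and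
  -- a walk to it must leave `w`.
  neighbour : Connected G → ¬ RegularBipartite G → ∀ w → ∃ (Adj G w)
  neighbour connected ¬rb w with any? (λ v → ¬? (v ≟ w))
  ... | yes (v , v≢w) with crossing (_≟ w) (walk⇒star G (connected w v)) refl v≢w
  ...   | _ , b , refl , _ , wb = b , wb
  neighbour connected ¬rb w | no none = contradiction
    ((λ u v → cong (deg G) (trans (only u) (sym (only v))))
    , (λ _ → false) , λ e _ _ → loopless G e (trans (only _) (sym (only _)))) ¬rb
    where
    only : ∀ v → v ≡ w
    only v = decidable-stable (v ≟ w) λ v≢w → none (v , v≢w)

  module _ (connected : Connected G) (¬rb : ¬ RegularBipartite G) where

    -- If `Z` is deficient once `x` is deleted, sending the spare vertex to `x` covers all
    -- neighbours of `Z` by images of `Z`, which the double count excludes.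
    matching-avoiding : ∀ {Y} → Independent G Y → ∀ x →
      Matching (λ y v → Adj G y v × v ≢ x) (λ v → v ∈ Y × deg G v ≡ Δ G)
    matching-avoiding {Y} indep x = Hall.hall (λ y v → adj? G y v ×-dec ¬? (v ≟ x))
      (λ v → (v ∈? Y) ×-dec (deg G v ℕ.≟ Δ G)) expanding
      where
      expanding : ∀ {Z} → (∀ {z} → z ∈ Z → z ∈ Y × deg G z ≡ Δ G) →
        ¬ Deficient (λ y v → Adj G y v × v ≢ x) Z
      expanding {Z} Z⊆ D = ¬rb (covered⇒regularBipartite G connected
        (λ u v u∈ v∈ → indep u v (proj₁ (Z⊆ u∈)) (proj₁ (Z⊆ v∈))) (proj₂ ∘ Z⊆)
        (cover D [ spare D ≔ x ]) covers′ (spare∈ D))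
        where
        covers′ : ∀ {z v} → z ∈ Z → Adj G z v → ∃ λ u → u ∈ Z × (cover D [ spare D ≔ x ]) u ≡ v
        covers′ {v = v} z∈ a with v ≟ x
        ... | yes refl = spare D , spare∈ D , ≔-new (cover D) (spare D)
        ... | no v≢x with covers D z∈ (a , v≢x)
        ...   | u , u∈ , u≢ , eq = u , u∈ , trans (≔-old (cover D) u≢) eq

    -- `Y` is grown from `y`, so its neighbour `r` is outside `Y` and can be the root.
    even-tree : ∀ {r y} → Adj G r y → Σ (EdgeSet G) λ S → SpanningTree G S ×
      Σ (Fin n → Bool) λ c → ProperOn G S c × c r ≡ false × c y ≡ true × WeaklyEven G S c
    even-tree {r} {y} ry@(e₀ , _) with spanning-independent G connected y
    ... | Y , y∈ , indep , reach
      with r∉Y ← (λ r∈ → indep r y r∈ y∈ ry)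
      with grow-tree indep r∉Y (λ v → (ry , inj₂ y∈) ◅ reach v) e₀
             (λ v → (v ∈? Y) ×-dec (deg G v ℕ.≟ Δ G)) proj₁ (matching-avoiding indep)
    ... | R , all∈ , K , T , K⊇ =
      treeEdges , spanningTree , colour , proper , false-at r∉Y , true-at , even
      where
      open SpanningTreeOf T all∈ indep r∉Y
      false-at : ∀ {v} → v ∉ Y → colour v ≡ false
      false-at {v} = dec-false (v ∈? Y)
      true-at : colour y ≡ true
      true-at = dec-true (y ∈? Y) y∈
      even : WeaklyEven G treeEdges colour
      even v leaf deg≡Δ = false-at λ v∈ → not-leaf v∈ (K⊇ v (all∈ v) (v∈ , deg≡Δ)) leaf

    weakly-even-tree : ∀ w l → Σ (EdgeSet G) λ S → SpanningWeaklyEvenTree G w l S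
    weakly-even-tree w l with neighbour connected ¬rb w
    weakly-even-tree w false | b , wb =
      let S , tree , c , prop , cw , _ , even = even-tree wb in S , tree , c , prop , cw , even
    -- For type 1 the roles swap: `w` seeds `Y` and its neighbour is the root.
    weakly-even-tree w true | b , wb =
      let S , tree , c , prop , _ , cw , even = even-tree (adj-sym G wb) in S , tree , c , prop , cw , even

  regular⇒deg≡Δ : Regular G → ∀ v → deg G v ≡ Δ G
  regular⇒deg≡Δ regular v =
    ≤-antisym (deg≤Δ G v) (max≤ (deg G) (λ u → ≤-reflexive (regular u v)) (allFin n))

monochromatic-tree : (n m : ℕ) (G : Graph n m) → Connected G → ¬ RegularBipartite G →
  Σ (EdgeSet G) λ S → SpanningTree G S × Σ (Fin n → Bool) λ c → ProperOn G S c ×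
    Σ Bool λ b → ∀ v → Leaf G S v → deg G v ≡ Δ G → c v ≡ b
-- The empty graph offers no vertex for `w`, but it is vacuously regular bipartite.
monochromatic-tree zero m G connected ¬rb =
  contradiction ((λ ()) , (λ ()) , λ e → contradiction (proj₁ (ends G e)) λ ()) ¬rb
monochromatic-tree (suc n) m G connected ¬rb =
  let S , tree , c , prop , _ , even = weakly-even-tree G connected ¬rb zero false
  in S , tree , c , prop , false , even

theorem1p5 : ((n m : ℕ) (G : Graph n m) → Connected G → ¬ RegularBipartite G →
    (w : Fin n) (l : Bool) → Σ (EdgeSet G) λ S → SpanningWeaklyEvenTree G w l S)
    × ((n m : ℕ) (G : Graph n m) → Connected G → ¬ RegularBipartite G →
    Σ (EdgeSet G) λ S → SpanningTree G S × Σ (Fin n → Bool) λ c → ProperOn G S c ×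
    Σ Bool λ b → ∀ v → Leaf G S v → deg G v ≡ Δ G → c v ≡ b)
    × ((n m : ℕ) (G : Graph n m) → Connected G → Regular G → ¬ Bipartite G →
    Σ (EdgeSet G) λ S → SpanningTree G S × Σ (Fin n → Bool) λ c → ProperOn G S c ×
    Σ Bool λ b → ∀ v → Leaf G S v → c v ≡ b)
theorem1p5 = (λ n m G → weakly-even-tree G) , monochromatic-tree ,
  -- In a regular graph every leaf has maximum degree.
  λ n m G connected regular ¬bipartite →
    let S , tree , c , prop , b , even = monochromatic-tree n m G connected (¬bipartite ∘ proj₂)
    in S , tree , c , prop , b , λ v leaf → even v leaf (regular⇒deg≡Δ G regular v)
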